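{- The ordered set $L_B(\infty)$ is a lattice. Moreover, if $a=(\infty,a_2,\dots,a_k)$ and $b=(\infty,b_2,\dots,b_l)$ are two elements of $L_B(\infty)$, then $\inf_{L_B(\infty)}(a,b)=c$, where $c=(\infty,c_2,c_3,\dots)$ is defined by $$c_i=\max\Big(\sum_{j\ge i}a_j,\ \sum_{j\ge i}b_j\Big)-\sum_{j>i}c_j\qquad\text{for all } i \text{ such that } 2\le i\le \max(k,l),$$ with $c_i=0$ for $i>\max(k,l)$.
   Context: Configurations are sequences $a=(a_1,a_2,\dots,a_k)$, non-increasing, with $a_1=\infty$ and $a_2,\dots,a_k$ positive integers; by convention $a_j=0$ for $j>k$. Let $d_i(a)=a_i-a_{i+1}$ (so $d_1(a)=\infty$). There are two evolution rules (transitions): (1) if $d_i(a)\ge 2$ (a cliff at $i$), one grain may fall from column $i$ to column $i+1$, i.e. $a_i$ is decreased by $1$ and $a_{i+1}$ increased by $1$ (with $\infty-1=\infty$); (2) if $a$ has a slippery step of length $m\ge 1$ at $i$, i.e. $a_i-1=a_{i+1}=\dots=a_{i+m}$ and $a_{i+m}-a_{i+m+1}=1$ (with $i\ge 2$), one grain may slip from column $i$ to column $i+m+1$, i.e. $a_i$ is decreased by $1$ and $a_{i+m+1}$ is increased by $1$. $L_B(\infty)$ is the set of all configurations reachable from $(\infty)$ by finitely many transitions, ordered by: $a\ge b$ iff $b$ can be reached from $a$ by a finite (possibly empty) sequence of transitions. Equivalently, for $a$ of length $p$ and $b$ of length $q$: $a\ge b$ iff $\sum_{i\ge j}a_i\le\sum_{i\ge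 j}b_i$ for all $j$ with $2\le j\le\max(p,q)$. -}

module Defs where

open import Data.List.Base using (List; []; _∷_; length; drop)
open import Data.List.Relation.Unary.All using (All; [])
open import Data.List.Relation.Unary.Linked using (Linked; [])
open import Data.Maybe.Base using () renaming (map to map⁺)
open import Data.Nat.Base using (ℕ; zero; suc; pred; _+_; _∸_; _≤_; _<_; _≥_)
open import Data.Nat.ListAction using (sum)
open import Data.Product.Base using (∃; proj₁)
open import Function.Base using (_on_)
open import Relation.Binary.Construct.Add.Supremum.NonStrict _≤_ using (_≤⁺_)
open import Relation.Binary.Construct.Closure.ReflexiveTransitive using (Star)
open import Relation.Binary.Core using (Rel)
open import Relation.Binary.PropositionalEquality using (_≡_; _≢_)
open import Relation.Nullary.Construct.Add.Supremum using (_⁺; ⊤⁺; [_])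
import Level

-- The configuration (∞, a₂, …, aₖ) is stored as the list a₂ ∷ … ∷ aₖ ∷ [] of
-- its finite columns; the first column is always ∞ and is left implicit.
record Config : Set where
  constructor config
  field
    piles         : List ℕ
    nonIncreasing : Linked _≥_ piles
    positive      : All (0 <_) piles

open Config public

infixl 9 _at_

_at_ : List ℕ → ℕ → ℕ
[]       at i     = 0
(x ∷ xs) at zero  = x
(x ∷ xs) at suc i = xs at i

-- Columns are numbered from 0: the mathematical a_j is height a (j ∸ 1),
-- with ⊤⁺ standing for ∞, and for j ≥ 2 it is pile a (j ∸ 2).
pile : Config → ℕ → ℕ
pile a i = piles a at i

height : Config → ℕ → ℕ ⁺
height a zero    = ⊤⁺
height a (suc i) = [ pile a i ]

-- Truncated subtraction is harmless here: configurations are non-increasing.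
d : Config → ℕ → ℕ ⁺
d a zero    = ⊤⁺
d a (suc i) = [ pile a i ∸ pile a (suc i) ]

-- map⁺ leaves ⊤⁺ fixed, which is the convention ∞ − 1 = ∞.
record MoveGrain (i j : ℕ) (a b : Config) : Set where
  field
    source : height b i ≡ map⁺ pred (height a i)
    target : height b j ≡ map⁺ suc (height a j)
    others : ∀ n → n ≢ i → n ≢ j → height b n ≡ height a n

Cliff : Config → ℕ → Set
Cliff a i = [ 2 ] ≤⁺ d a i

record SlipperyStep (a : Config) (i m : ℕ) : Set where
  field
    notFirst : 1 ≤ i
    length≥1 : 1 ≤ m
    plateau  : ∀ j → 1 ≤ j → j ≤ m → height a i ≡ map⁺ suc (height a (i + j))
    end      : d a (i + m) ≡ [ 1 ]

infix 4 _⟶_ _⟶*_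

data _⟶_ (a b : Config) : Set where
  fall : ∀ i → Cliff a i → MoveGrain i (suc i) a b → a ⟶ b
  slip : ∀ i m → SlipperyStep a i m → MoveGrain i (suc (i + m)) a b → a ⟶ b

_⟶*_ : Rel Config Level.zero
_⟶*_ = Star _⟶_

⟨∞⟩ : Config
⟨∞⟩ = config [] [] []

L[∞] : Set
L[∞] = ∃ λ a → ⟨∞⟩ ⟶* a

infix 4 _≈ᴸ_ _≤ᴸ_

-- Elements of L[∞] are compared as configurations, ignoring which sequence of
-- transitions from ⟨∞⟩ witnesses membership.
_≈ᴸ_ : Rel L[∞] Level.zero
_≈ᴸ_ = _≡_ on proj₁

_≤ᴸ_ : Rel L[∞] Level.zero
b ≤ᴸ a = proj₁ a ⟶* proj₁ b

-- The number of finite columns: k ∸ 1 for (∞, a₂, …, aₖ).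
width : L[∞] → ℕ
width a = length (piles (proj₁ a))

column : L[∞] → ℕ → ℕ
column a = pile (proj₁ a)

-- The sum of column a j over all j ≥ i.
tailSum : L[∞] → ℕ → ℕ
tailSum a i = sum (drop i (piles (proj₁ a)))

{-# OPTIONS --safe #-}

-- Reachability coincides with pointwise comparison of tail sums. A transition
-- from column i to column j adds 1 to the tail sums at i+1, …, j, so it never
-- decreases them. Conversely, if the tail sums of a are at most those of b and
-- a_t < b_t for some t, there is a transition out of a that stays above b. Since
-- the first column is infinite, every configuration is therefore reachable from
-- (∞). Tail sums of configurations are exactly the convex sequences that vanish
-- eventually, and these are closed under pointwise maxima, which gives meets. Only
-- finitely many configurations lie above a given one, so the join is the meet of
-- all upper bounds.
module Submission where

open import Defs
open import Algebra.Core using (Op₂)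
open import Data.Integer.Base using (+_; _-_)
open import Data.Nat.Base using (ℕ; suc; _⊔_; _≤_; _<_)
open import Data.Product.Base using (_×_; ∃₂)
open import Relation.Binary.Lattice.Structures using (IsLattice)
open import Relation.Binary.PropositionalEquality using (_≡_)

import Data.Integer.Properties as ℤ
open import Data.Integer.Base using (_⊖_)
open import Data.List.Base
  using (List; []; _∷_; length; drop; foldr; map; filter; upTo; cartesianProductWith)
open import Data.List.Membership.Propositional using (_∈_)
open import Data.List.Membership.Propositional.Properties
  using (∈-cartesianProductWith⁺; ∈-upTo⁺; ∈-map⁺; ∈-filter⁺)
open import Data.List.Relation.Unary.All as All using (All; []; _∷_; all?)
open import Data.List.Relation.Unary.All.Properties using (all-filter)
open import Data.List.Relation.Unary.Any using (here; there)
open import Data.List.Relation.Unary.Linked as Linked using (Linked; []; [-]; _∷_; linked?)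
open import Data.Nat.Base
  using (zero; pred; _+_; _∸_; _≥_; z≤n; s≤s; z<s; s<s⁻¹; s≤s⁻¹)
open import Data.Maybe.Base using () renaming (map to map⁺)
open import Data.Nat.ListAction using (sum)
open import Data.Nat.Properties
open import Algebra.Properties.CommutativeSemigroup +-commutativeSemigroup using (interchange)
open import Data.Product.Base using (_,_; ∃; proj₁; proj₂)
open import Data.Sum.Base using (_⊎_; inj₁; inj₂)
open import Function.Base using (_∘_)
open import Relation.Binary.Construct.Add.Supremum.NonStrict _≤_ using ([_]; _≤⊤⁺)
open import Relation.Binary.Construct.Closure.ReflexiveTransitive using (ε; _◅_; _◅◅_)
import Relation.Binary.Construct.On as On
open import Relation.Binary.PropositionalEquality
  using (_≢_; refl; sym; trans; cong; cong₂; subst; isEquivalence; module ≡-Reasoning)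
open import Relation.Nullary.Construct.Add.Supremum using ([_])
open import Relation.Nullary.Decidable using (Dec; yes; no; _×-dec_; map′)
open import Relation.Nullary.Negation.Core using (contradiction)

-- Antitone sequences and downward induction

Antitone : (ℕ → ℕ) → Set
Antitone f = ∀ n → f (suc n) ≤ f n

antitone-≤ : ∀ {f} → Antitone f → ∀ {m n} → m ≤ n → f n ≤ f m
antitone-≤ {f} anti {m} {zero}  z≤n = ≤-refl
antitone-≤ {f} anti {m} {suc n} m≤1+n with m≤n⇒m<n∨m≡n m≤1+n
... | inj₁ m<1+n = ≤-trans (anti n) (antitone-≤ anti (s≤s⁻¹ m<1+n))
... | inj₂ refl  = ≤-refl

-- Tail sums vanish far to the right and each is obtained from the next one, so statements about
-- them are proved from right to left.
descending : (P : ℕ → Set) (N : ℕ) → (∀ n → N ≤ n → P n) →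
             (∀ n → P (suc n) → P n) → ∀ n → P n
descending P N base step n = go N n (m≤m+n N n)
  where
  go : ∀ k n → N ≤ k + n → P n
  go zero    n N≤n   = base n N≤n
  go (suc k) n N≤k+n = step n (go k (suc n) (subst (N ≤_) (sym (+-suc k n)) N≤k+n))

-- Configurations as functions

at-antitone : ∀ {xs} → Linked _≥_ xs → Antitone (xs at_)
at-antitone []       n       = z≤n
at-antitone [-]      n       = z≤n
at-antitone (p ∷ ps) zero    = p
at-antitone (p ∷ ps) (suc n) = at-antitone ps n

antitone-at : ∀ xs → Antitone (xs at_) → Linked _≥_ xs
antitone-at []           anti = []
antitone-at (x ∷ [])     anti = [-]
antitone-at (x ∷ y ∷ xs) anti = anti 0 ∷ antitone-at (y ∷ xs) (anti ∘ suc)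

at-beyond : ∀ xs {n} → length xs ≤ n → xs at n ≡ 0
at-beyond []       _          = refl
at-beyond (x ∷ xs) (s≤s len≤n) = at-beyond xs len≤n

pile-antitone : ∀ a → Antitone (pile a)
pile-antitone a = at-antitone (nonIncreasing a)

-- Reading past the end gives 0, so only trailing zeros could be lost in passing to functions, and
-- positivity excludes them.
positive-ext : ∀ {xs ys} → All (0 <_) xs → All (0 <_) ys →
               (∀ n → xs at n ≡ ys at n) → xs ≡ ys
positive-ext []       []       _  = refl
positive-ext []       (q ∷ qs) eq = contradiction (eq 0) (<⇒≢ q)
positive-ext (p ∷ ps) []       eq = contradiction (sym (eq 0)) (<⇒≢ p)
positive-ext (p ∷ ps) (q ∷ qs) eq = cong₂ _∷_ (eq 0) (positive-ext ps qs (eq ∘ suc))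

piles-injective : ∀ {a b} → piles a ≡ piles b → a ≡ b
piles-injective {config _ p q} {config _ p′ q′} refl =
  cong₂ (config _) (Linked.irrelevant ≤-irrelevant p p′) (All.irrelevant ≤-irrelevant q q′)

pile-ext : ∀ {a b} → (∀ n → pile a n ≡ pile b n) → a ≡ b
pile-ext {a} {b} eq = piles-injective (positive-ext (positive a) (positive b) eq)

consPositive : ℕ → List ℕ → List ℕ
consPositive zero    xs = []
consPositive (suc x) xs = suc x ∷ xs

-- Cutting at the first zero secures positivity and, for an antitone sequence that vanishes at `n`,
-- discards only zeros.
positivePrefix : ℕ → (ℕ → ℕ) → List ℕ
positivePrefix zero    f = []
positivePrefix (suc n) f = consPositive (f 0) (positivePrefix n (f ∘ suc))

positivePrefix-positive : ∀ n f → All (0 <_) (positivePrefix n f)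
positivePrefix-positive zero    f = []
positivePrefix-positive (suc n) f with f 0
... | zero  = []
... | suc x = z<s ∷ positivePrefix-positive n (f ∘ suc)

positivePrefix-at : ∀ n {f} → Antitone f → f n ≡ 0 → ∀ i → positivePrefix n f at i ≡ f i
positivePrefix-at zero    {f} anti f0≡0 i =
  sym (n≤0⇒n≡0 (subst (f i ≤_) f0≡0 (antitone-≤ anti z≤n)))
positivePrefix-at (suc n) {f} anti fn≡0 i with f 0 in eq
positivePrefix-at (suc n) {f} anti fn≡0 i       | zero =
  sym (n≤0⇒n≡0 (subst (f i ≤_) eq (antitone-≤ anti z≤n)))
positivePrefix-at (suc n) {f} anti fn≡0 zero    | suc x = sym eq
positivePrefix-at (suc n) {f} anti fn≡0 (suc i) | suc x =
  positivePrefix-at n (anti ∘ suc) fn≡0 i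

fromFunction : ∀ n f → Antitone f → f n ≡ 0 → ∃ λ a → ∀ i → pile a i ≡ f i
fromFunction n f anti fn≡0 =
  config (positivePrefix n f)
    (antitone-at _ (λ i → ≤-trans (≤-reflexive (eq (suc i)))
                            (≤-trans (anti i) (≤-reflexive (sym (eq i))))))
    (positivePrefix-positive n f) ,
  eq
  where eq = positivePrefix-at n anti fn≡0

-- Tail sums and the dominance order

tail : Config → ℕ → ℕ
tail a n = sum (drop n (piles a))

sum-drop : ∀ xs n → sum (drop n xs) ≡ xs at n + sum (drop (suc n) xs)
sum-drop []       zero    = refl
sum-drop []       (suc n) = refl
sum-drop (x ∷ xs) zero    = refl
sum-drop (x ∷ xs) (suc n) = sum-drop xs n

tail-suc : ∀ a n → tail a n ≡ pile a n + tail a (suc n)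
tail-suc a = sum-drop (piles a)

sum-drop-beyond : ∀ xs {n} → length xs ≤ n → sum (drop n xs) ≡ 0
sum-drop-beyond []       {zero}  _           = refl
sum-drop-beyond []       {suc n} _           = refl
sum-drop-beyond (x ∷ xs) {suc n} (s≤s len≤n) = sum-drop-beyond xs len≤n

tail-beyond : ∀ a {n} → length (piles a) ≤ n → tail a n ≡ 0
tail-beyond a = sum-drop-beyond (piles a)

tail-antitone : ∀ a → Antitone (tail a)
tail-antitone a n = ≤-trans (m≤n+m _ _) (≤-reflexive (sym (tail-suc a n)))

pile-tail : ∀ a n → pile a n ≡ tail a n ∸ tail a (suc n)
pile-tail a n = sym (trans (cong (_∸ tail a (suc n)) (tail-suc a n))
                           (m+n∸n≡m (pile a n) (tail a (suc n))))

tail-mono : ∀ a b → (∀ n → pile a n ≤ pile b n) → ∀ n → tail a n ≤ tail b n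
tail-mono a b le = descending _ (length (piles a))
  (λ n len≤n → subst (_≤ tail b n) (sym (tail-beyond a len≤n)) z≤n)
  (λ n ih → ≤-trans (≤-reflexive (tail-suc a n))
              (≤-trans (+-mono-≤ (le n) ih) (≤-reflexive (sym (tail-suc b n)))))

infix 4 _≽_

-- Grains move to the right as configurations go down, so the larger element has the smaller tail
-- sums. Index 0 is the first finite column; beyond both lengths the comparison reads 0 ≤ 0.
_≽_ : Config → Config → Set
a ≽ b = ∀ n → tail a n ≤ tail b n

≽-antisym : ∀ {a b} → a ≽ b → b ≽ a → a ≡ b
≽-antisym {a} {b} a≽b b≽a = pile-ext λ n → begin
  pile a n                    ≡⟨ pile-tail a n ⟩
  tail a n ∸ tail a (suc n)   ≡⟨ cong₂ _∸_ (eq n) (eq (suc n)) ⟩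
  tail b n ∸ tail b (suc n)   ≡⟨ sym (pile-tail b n) ⟩
  pile b n                    ∎
  where
  open ≡-Reasoning
  eq : ∀ n → tail a n ≡ tail b n
  eq n = ≤-antisym (a≽b n) (b≽a n)

⟨∞⟩-≽ : ∀ a → ⟨∞⟩ ≽ a
⟨∞⟩-≽ a zero    = z≤n
⟨∞⟩-≽ a (suc n) = z≤n

-- Transitions increase tail sums

δ : ℕ → ℕ → ℕ
δ zero    zero    = 1
δ zero    (suc n) = 0
δ (suc k) zero    = 0
δ (suc k) (suc n) = δ k n

δ-refl : ∀ k → δ k k ≡ 1
δ-refl zero    = refl
δ-refl (suc k) = δ-refl k

δ-≢ : ∀ {k n} → n ≢ k → δ k n ≡ 0
δ-≢ {zero}  {zero}  n≢k = contradiction refl n≢k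
δ-≢ {zero}  {suc n} n≢k = refl
δ-≢ {suc k} {zero}  n≢k = refl
δ-≢ {suc k} {suc n} n≢k = δ-≢ (n≢k ∘ cong suc)

-- The tail sum at n of a single grain at height index k; none is counted for
-- k = 0, the infinite column.
below : ℕ → ℕ → ℕ
below zero    n       = 0
below (suc k) zero    = 1
below (suc k) (suc n) = below k n

below-suc : ∀ k n → below k n ≡ δ k (suc n) + below k (suc n)
below-suc zero          n       = refl
below-suc (suc zero)    zero    = refl
below-suc (suc (suc k)) zero    = refl
below-suc (suc k)       (suc n) = below-suc k n

below-< : ∀ {k n} → n < k → below k n ≡ 1
below-< {suc k} {zero}  _         = refl
below-< {suc k} {suc n} (s≤s n<k) = below-< n<k

below-≥ : ∀ {k n} → k ≤ n → below k n ≡ 0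
below-≥ {zero}          _         = refl
below-≥ {suc k} {suc n} (s≤s k≤n) = below-≥ k≤n

below-≤1 : ∀ k n → below k n ≤ 1
below-≤1 zero    n       = z≤n
below-≤1 (suc k) zero    = ≤-refl
below-≤1 (suc k) (suc n) = below-≤1 k n

below-mono : ∀ {i j} → i ≤ j → ∀ n → below i n ≤ below j n
below-mono {zero}          _         n       = z≤n
below-mono {suc i} {suc j} (s≤s i≤j) zero    = ≤-refl
below-mono {suc i} {suc j} (s≤s i≤j) (suc n) = below-mono i≤j n

[]-injective : ∀ {m n : ℕ} → _≡_ {A = _} [ m ] [ n ] → m ≡ n
[]-injective refl = refl

-- Both sides are additive to avoid truncated subtraction. For `i < j` the tail sum grows by 1
-- exactly at the `n` with `i ≤ n < j`, because pile index `n` is height index `suc n`.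
Shifts : ℕ → ℕ → Config → Config → Set
Shifts i j a b = ∀ n → tail b n + below i n ≡ tail a n + below j n

-- Positivity of the source makes `pred` a genuine subtraction. Height index 0, the infinite column,
-- is met by no pile index.
moveGrain-pile : ∀ {i j a b} → i < j → MoveGrain i j a b →
                 (∀ n → suc n ≡ i → 0 < pile a n) →
                 ∀ n → pile b n + δ i (suc n) ≡ pile a n + δ j (suc n)
moveGrain-pile {i} {j} {a} {b} i<j move pos n with suc n ≟ i | suc n ≟ j
... | yes refl | yes refl = contradiction refl (<⇒≢ i<j)
... | yes refl | no n≢j = begin
  pile b n + δ i i            ≡⟨ cong₂ _+_ ([]-injective (MoveGrain.source move)) (δ-refl i) ⟩
  pred (pile a n) + 1         ≡⟨ m∸n+n≡m (pos n refl) ⟩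
  pile a n                    ≡⟨ sym (+-identityʳ _) ⟩
  pile a n + 0                ≡⟨ cong (_+_ (pile a n)) (sym (δ-≢ n≢j)) ⟩
  pile a n + δ j i            ∎
  where open ≡-Reasoning
... | no n≢i | yes refl = begin
  pile b n + δ i j            ≡⟨ cong₂ _+_ ([]-injective (MoveGrain.target move)) (δ-≢ n≢i) ⟩
  suc (pile a n) + 0          ≡⟨ sym (+-suc (pile a n) 0) ⟩
  pile a n + 1                ≡⟨ cong (_+_ (pile a n)) (sym (δ-refl j)) ⟩
  pile a n + δ j j            ∎
  where open ≡-Reasoning
... | no n≢i | no n≢j =
  cong₂ _+_ ([]-injective (MoveGrain.others move (suc n) n≢i n≢j))
            (trans (δ-≢ n≢i) (sym (δ-≢ n≢j)))

pile⇒shifts : ∀ {i j a b} → i < j →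
              (∀ n → pile b n + δ i (suc n) ≡ pile a n + δ j (suc n)) → Shifts i j a b
pile⇒shifts {i} {j} {a} {b} i<j eq =
  descending _ (length (piles a) ⊔ length (piles b) ⊔ j) base step
  where
  open ≡-Reasoning
  base : ∀ n → length (piles a) ⊔ length (piles b) ⊔ j ≤ n →
         tail b n + below i n ≡ tail a n + below j n
  base n N≤n = trans
    (cong₂ _+_ (tail-beyond b (m⊔n≤o⇒n≤o (length (piles a)) _ ab≤n))
               (below-≥ (≤-trans (<⇒≤ i<j) j≤n)))
    (sym (cong₂ _+_ (tail-beyond a (m⊔n≤o⇒m≤o _ (length (piles b)) ab≤n)) (below-≥ j≤n)))
    where
    ab≤n = m⊔n≤o⇒m≤o (length (piles a) ⊔ length (piles b)) j N≤n
    j≤n  = m⊔n≤o⇒n≤o (length (piles a) ⊔ length (piles b)) j N≤n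
  split : ∀ c k n → tail c n + below k n ≡
          (pile c n + δ k (suc n)) + (tail c (suc n) + below k (suc n))
  split c k n = trans (cong₂ _+_ (tail-suc c n) (below-suc k n)) (interchange (pile c n) _ _ _)
  step : ∀ n → tail b (suc n) + below i (suc n) ≡ tail a (suc n) + below j (suc n) →
         tail b n + below i n ≡ tail a n + below j n
  step n ih = trans (split b i n) (trans (cong₂ _+_ (eq n) ih) (sym (split a j n)))

cliff-drop : ∀ {a i} → Cliff a i → ∀ n → suc n ≡ i → 2 + pile a (suc n) ≤ pile a n
cliff-drop {a} [ 2≤d ] n refl = m≤o∸n⇒m+n≤o 2 (pile-antitone a n) 2≤d

fall-shifts : ∀ {a b i} → Cliff a i → MoveGrain i (suc i) a b → Shifts i (suc i) a b
fall-shifts {a} {b} cliff move = pile⇒shifts {a = a} {b} ≤-refl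
  (moveGrain-pile ≤-refl move (λ n eq → ≤-trans z<s (cliff-drop {a} cliff n eq)))

slip-shifts : ∀ {a b i m} → SlipperyStep a i m → MoveGrain i (suc (i + m)) a b →
              Shifts i (suc (i + m)) a b
slip-shifts {a} {b} {i} {m} s move = pile⇒shifts {a = a} {b} i<j (moveGrain-pile i<j move
  (λ { n refl → ≤-trans z<s (≤-reflexive (sym ([]-injective (plateau 1 ≤-refl length≥1)))) }))
  where
  open SlipperyStep s
  i<j = s≤s (m≤m+n i m)

⟶⇒shifts : ∀ {a b} → a ⟶ b → ∃₂ λ i j → i < j × Shifts i j a b
⟶⇒shifts {a} {b} (fall i cliff move) = i , suc i , ≤-refl , fall-shifts {a} {b} cliff move
⟶⇒shifts {a} {b} (slip i m s move)   =
  i , suc (i + m) , s≤s (m≤m+n i m) , slip-shifts {a} {b} s move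

shifts-≽ : ∀ {i j a b} → i < j → Shifts i j a b → a ≽ b
shifts-≽ {i} {j} {a} {b} i<j sh n = +-cancelʳ-≤ (below i n) _ _ (begin
  tail a n + below i n  ≤⟨ +-monoʳ-≤ (tail a n) (below-mono (<⇒≤ i<j) n) ⟩
  tail a n + below j n  ≡⟨ sym (sh n) ⟩
  tail b n + below i n  ∎)
  where open ≤-Reasoning

shifts-strict : ∀ {i j a b} → i < j → Shifts i j a b → ∃ λ n → tail a n < tail b n
-- The tail that starts at the target column gains the grain and does not contain the source.
shifts-strict {i} {suc j} {a} {b} (s≤s i≤j) sh = j , (begin-strict
  tail a j                    <⟨ ≤-reflexive (sym (+-comm (tail a j) 1)) ⟩
  tail a j + 1                ≡⟨ cong (_+_ (tail a j)) (sym (below-< {suc j} ≤-refl)) ⟩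
  tail a j + below (suc j) j  ≡⟨ sym (sh j) ⟩
  tail b j + below i j        ≡⟨ cong (_+_ (tail b j)) (below-≥ i≤j) ⟩
  tail b j + 0                ≡⟨ +-identityʳ _ ⟩
  tail b j                    ∎)
  where open ≤-Reasoning

-- A tail sum changes only for `i ≤ n < j`, and there by 1, which a strict gap to `b` absorbs.
shifts-bound : ∀ {i j a a′ b} → i < j → Shifts i j a a′ → a ≽ b →
               (∀ n → i ≤ n → n < j → tail a n < tail b n) → a′ ≽ b
shifts-bound {i} {j} {a} {a′} {b} i<j sh a≽b gap n with i ≤? n | n <? j
... | yes i≤n | yes n<j = begin
  tail a′ n              ≤⟨ m≤m+n _ _ ⟩
  tail a′ n + below i n  ≡⟨ sh n ⟩
  tail a n + below j n   ≤⟨ +-monoʳ-≤ (tail a n) (below-≤1 j n) ⟩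
  tail a n + 1           ≡⟨ +-comm (tail a n) 1 ⟩
  suc (tail a n)         ≤⟨ gap n i≤n n<j ⟩
  tail b n               ∎
  where open ≤-Reasoning
... | yes i≤n | no n≮j =
  subst (_≤ tail b n)
    (sym (+-cancelʳ-≡ (below i n) _ _
      (trans (sh n) (cong (_+_ (tail a n)) (trans (below-≥ (≮⇒≥ n≮j)) (sym (below-≥ i≤n)))))))
    (a≽b n)
... | no i≰n | _ =
  subst (_≤ tail b n)
    (sym (+-cancelʳ-≡ (below i n) _ _
      (trans (sh n) (cong (_+_ (tail a n))
        (trans (below-< (<-trans (≰⇒> i≰n) i<j)) (sym (below-< (≰⇒> i≰n))))))))
    (a≽b n)

⟶*⇒≽ : ∀ {a b} → a ⟶* b → a ≽ b
⟶*⇒≽ ε        n = ≤-refl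
⟶*⇒≽ {a} (_◅_ {j = c} s ss) n with _ , _ , i<j , sh ← ⟶⇒shifts s =
  ≤-trans (shifts-≽ {a = a} {c} i<j sh n) (⟶*⇒≽ ss n)

-- Dominance implies reachability

-- Monotonicity can break only between the source and its right neighbour, or between the target and
-- its left one. The `δ` term accounts for a target directly to the right of the source.
moveGrain : ∀ a i j → i < j →
            (∀ n → suc n ≡ i → pile a (suc n) + δ j (suc (suc n)) < pile a n) →
            (∀ n → suc n ≢ i → suc (suc n) ≡ j → pile a (suc n) < pile a n) →
            ∃ λ b → MoveGrain i j a b
moveGrain a i zero    () _ _
moveGrain a i (suc j) i<j atSource atTarget = b , record
  { source = atHeight i refl
  ; target = cong [_] (trans (eq j) (begin
      (pile a j + δ j j) ∸ δ i (suc j)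
        ≡⟨ cong₂ _∸_ (cong (_+_ (pile a j)) (δ-refl j)) (δ-≢ (<⇒≢ i<j ∘ sym)) ⟩
      pile a j + 1                      ≡⟨ +-comm (pile a j) 1 ⟩
      suc (pile a j)                    ∎))
  ; others = others
  }
  where
  open ≡-Reasoning
  f : ℕ → ℕ
  f n = (pile a n + δ (suc j) (suc n)) ∸ δ i (suc n)
  anti : Antitone f
  anti n with suc n ≟ i | n ≟ j | suc n ≟ j
  ... | yes refl | yes refl | _ = contradiction refl (<⇒≢ i<j)
  ... | yes refl | no n≢j | _ rewrite δ-≢ n≢j | δ-refl n | +-identityʳ (pile a n) =
    ≤-trans (m∸n≤m _ (δ n (suc n))) (<⇒≤pred (atSource n refl))
  ... | no n≢i | _ | yes refl rewrite δ-≢ n≢i | δ-refl (suc n) | +-comm (pile a (suc n)) 1 =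
    ≤-trans (m∸n≤m _ (δ i (suc (suc n))))
            (≤-trans (atTarget n n≢i refl) (m≤m+n _ _))
  ... | no n≢i | _ | no 1+n≢j rewrite δ-≢ n≢i | δ-≢ 1+n≢j | +-identityʳ (pile a (suc n)) =
    ≤-trans (m∸n≤m _ (δ i (suc (suc n))))
            (≤-trans (pile-antitone a n) (m≤m+n _ _))
  -- Beyond both the last pile of `a` and the target column, whose pile index is `j`.
  N = length (piles a) + suc j
  fN≡0 : f N ≡ 0
  fN≡0 rewrite at-beyond (piles a) {N} (m≤m+n _ _)
             | δ-≢ {j} {N} (<⇒≢ (m≤n+m (suc j) (length (piles a))) ∘ sym) = 0∸n≡0 (δ i (suc N))
  b : Config
  b = proj₁ (fromFunction N f anti fN≡0)
  eq : ∀ n → pile b n ≡ f n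
  eq = proj₂ (fromFunction N f anti fN≡0)
  atHeight : ∀ k → k ≡ i → height b k ≡ map⁺ pred (height a k)
  atHeight zero    refl = refl
  atHeight (suc k) refl = cong [_] (trans (eq k) (begin
    (pile a k + δ j k) ∸ δ k k
      ≡⟨ cong₂ _∸_ (cong (_+_ (pile a k)) (δ-≢ (<⇒≢ (s<s⁻¹ i<j)))) (δ-refl k) ⟩
    (pile a k + 0) ∸ 1          ≡⟨ cong pred (+-identityʳ (pile a k)) ⟩
    pred (pile a k)             ∎))
  others : ∀ n → n ≢ i → n ≢ suc j → height b n ≡ height a n
  others zero    _   _   = refl
  others (suc n) n≢i n≢j = cong [_] (trans (eq n) (begin
    (pile a n + δ j n) ∸ δ i (suc n)
      ≡⟨ cong₂ _∸_ (cong (_+_ (pile a n)) (δ-≢ (n≢j ∘ cong suc))) (δ-≢ n≢i) ⟩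
    pile a n + 0                      ≡⟨ +-identityʳ _ ⟩
    pile a n                          ∎))

fallAt : ∀ a i → Cliff a i → ∃ λ b → a ⟶ b × Shifts i (suc i) a b
fallAt a i cliff =
  let b , move = moveGrain a i (suc i) ≤-refl drop≥2
                   (λ { n 1+n≢i refl → contradiction refl 1+n≢i })
  in b , fall i cliff move , fall-shifts {a} {b} cliff move
  where
  drop≥2 : ∀ n → suc n ≡ i → pile a (suc n) + δ (suc i) (suc (suc n)) < pile a n
  drop≥2 n refl rewrite δ-refl n | +-comm (pile a (suc n)) 1 = cliff-drop {a} cliff n refl

slipAt : ∀ a i m → SlipperyStep a i m → ∃ λ b → a ⟶ b × Shifts i (suc (i + m)) a b
slipAt a i m s =
  let b , move = moveGrain a i (suc (i + m)) (s≤s (m≤m+n i m)) atSource atTarget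
  in b , slip i m s move , slip-shifts {a} {b} s move
  where
  open SlipperyStep s
  atSource : ∀ n → suc n ≡ i → pile a (suc n) + δ (suc (i + m)) (suc (suc n)) < pile a n
  atSource n refl
    rewrite δ-≢ {suc n + m} {suc n} (<⇒≢ (m<m+n (suc n) length≥1))
          | +-identityʳ (pile a (suc n))
          | []-injective (plateau 1 ≤-refl length≥1)
          | +-comm n 1 = ≤-refl
  atTarget : ∀ n → suc n ≢ i → suc (suc n) ≡ suc (i + m) → pile a (suc n) < pile a n
  -- The plateau ends with a drop of 1, which leaves room for one more grain in the target column.
  atTarget n _ eq = m∸n≢0⇒n<m λ d≡0 → contradiction (trans (sym d≡0) d≡1) λ ()
    where
    d≡1 : pile a n ∸ pile a (suc n) ≡ 1
    d≡1 = []-injective (subst (λ k → d a k ≡ [ 1 ]) (sym (suc-injective eq)) end)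

-- Height index `r` is the column just left of pile index `r`, so both alternatives describe the
-- step down onto pile `r`: at least 2, or exactly 1.
Edge : Config → ℕ → Set
Edge a r = Cliff a r ⊎ ∃ λ r′ → r ≡ suc r′ × pile a r′ ≡ suc (pile a r)

-- Walk left along equal piles. The search stops at the latest at the infinite column, which is
-- always a cliff.
plateauStart : ∀ a t → ∃ λ r → r ≤ t × pile a r ≡ pile a t × Edge a r
plateauStart a zero = 0 , ≤-refl , refl , inj₁ (_ ≤⊤⁺)
plateauStart a (suc t) with pile a t ≤? pile a (suc t) | 2 + pile a (suc t) ≤? pile a t
... | yes flat | _ with r , r≤t , eq , edge ← plateauStart a t =
  r , m≤n⇒m≤1+n r≤t , trans eq (≤-antisym flat (pile-antitone a t)) , edge
... | no steep | yes cliff = suc t , ≤-refl , refl , inj₁ [ m+n≤o⇒m≤o∸n 2 cliff ]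
... | no steep | no ¬cliff =
  suc t , ≤-refl , refl , inj₂ (t , refl , ≤-antisym (s≤s⁻¹ (≰⇒> ¬cliff)) (≰⇒> steep))

-- On [q, t] the piles of b are at least b_t ≥ a_q, hence at least those of a.
tail-gap : ∀ {a b q t} → a ≽ b → pile a t < pile b t → pile a q ≤ pile b t →
           ∀ n → q ≤ n → n ≤ t → tail a n < tail b n
tail-gap {a} {b} {q} {t} a≽b at<bt aq≤bt n q≤n n≤t =
  go (t ∸ n) n q≤n (m∸n+n≡m n≤t)
  where
  open ≤-Reasoning
  go : ∀ k n → q ≤ n → k + n ≡ t → tail a n < tail b n
  go zero n _ refl = begin-strict
    tail a n                   ≡⟨ tail-suc a n ⟩
    pile a n + tail a (suc n)  <⟨ +-mono-<-≤ at<bt (a≽b (suc n)) ⟩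
    pile b n + tail b (suc n)  ≡⟨ sym (tail-suc b n) ⟩
    tail b n                   ∎
  go (suc k) n q≤n refl = begin-strict
    tail a n                   ≡⟨ tail-suc a n ⟩
    pile a n + tail a (suc n)  <⟨ +-mono-≤-< an≤bn (go k (suc n) (m≤n⇒m≤1+n q≤n) (+-suc k n)) ⟩
    pile b n + tail b (suc n)  ≡⟨ sym (tail-suc b n) ⟩
    tail b n                   ∎
    where
    an≤bn : pile a n ≤ pile b n
    an≤bn = ≤-trans (antitone-≤ (pile-antitone a) q≤n)
              (≤-trans aq≤bt (antitone-≤ (pile-antitone b) (m≤n+m n (suc k))))

-- With r the start of the plateau of column t, a grain may fall onto r unless the
-- step before r has height 1. In that case let q be the start of the preceding
-- plateau: a grain may fall onto q, or slip from the column before q to r.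
stepTowards : ∀ {a b t} → a ≽ b → pile a t < pile b t → ∃ λ a′ → a ⟶ a′ × a′ ≽ b
stepTowards {a} {b} {t} a≽b at<bt with plateauStart a t
... | r , r≤t , ar≡at , inj₁ cliff with a′ , s , sh ← fallAt a r cliff =
  a′ , s , shifts-bound {a = a} {a′} {b} ≤-refl sh a≽b
    (λ n r≤n n<1+r → tail-gap {a} {b} {r} a≽b at<bt
      (≤-trans (≤-reflexive ar≡at) (<⇒≤ at<bt)) n r≤n (≤-trans (s≤s⁻¹ n<1+r) r≤t))
... | suc r′ , r≤t , ar≡at , inj₂ (r′ , refl , ar′≡1+ar) with plateauStart a r′
... | q , q≤r′ , aq≡ar′ , edge = next edge
  where
  gap : ∀ n → q ≤ n → n ≤ t → tail a n < tail b n
  -- Here `a_q = a_t + 1 ≤ b_t`, so the strict gap extends left through the preceding plateau.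
  gap = tail-gap {a} {b} {q} a≽b at<bt (subst (_≤ pile b t)
    (sym (trans aq≡ar′ (trans ar′≡1+ar (cong suc ar≡at)))) at<bt)
  next : Edge a q → ∃ λ a′ → a ⟶ a′ × a′ ≽ b
  next (inj₁ cliff) with a′ , s , sh ← fallAt a q cliff =
    a′ , s , shifts-bound {a = a} {a′} {b} ≤-refl sh a≽b
      (λ n q≤n n<1+q → gap n q≤n (≤-trans (s≤s⁻¹ n<1+q) (≤-trans q≤r′ (<⇒≤ r≤t))))
  next (inj₂ (q′ , refl , aq′≡1+aq)) =
    -- The plateau occupies piles `q` to `r′`, hence the length `suc r′ ∸ q`; the grain lands on
    -- pile `suc r′`, where the plateau of `t` starts.
    let a′ , s , sh = slipAt a q (suc r′ ∸ q) slippery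
    in a′ , s , shifts-bound {a = a} {a′} {b} (s≤s (m≤m+n q _)) sh a≽b
         (λ n q≤n n<j → gap n q≤n
           (≤-trans (subst (n ≤_) q+m≡1+r′ (s≤s⁻¹ n<j)) r≤t))
    where
    q+m≡1+r′ : q + (suc r′ ∸ q) ≡ suc r′
    q+m≡1+r′ = m+[n∸m]≡n (m≤n⇒m≤1+n q≤r′)
    level : ∀ j → 1 ≤ j → j ≤ suc r′ ∸ q → pile a q′ ≡ suc (pile a (q′ + j))
    -- Piles `q` and `r′` agree, so by monotonicity every pile between them has the same height.
    level (suc j) _ 1+j≤m = trans aq′≡1+aq (cong suc (≤-antisym
      (subst (_≤ pile a (q′ + suc j)) (sym aq≡ar′) (antitone-≤ (pile-antitone a) (s≤s⁻¹
        (≤-trans (+-monoʳ-≤ q 1+j≤m) (≤-reflexive q+m≡1+r′)))))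
      (antitone-≤ (pile-antitone a) (≤-trans (s≤s (m≤m+n q′ j)) (≤-reflexive (sym (+-suc q′ j)))))))
    slippery : SlipperyStep a q (suc r′ ∸ q)
    slippery = record
      { notFirst = s≤s z≤n
      ; length≥1 = m<n⇒0<n∸m (s≤s q≤r′)
      ; plateau  = λ j 1≤j j≤m → cong [_] (level j 1≤j j≤m)
      ; end      = subst (λ k → d a k ≡ [ 1 ]) (sym q+m≡1+r′)
                     (cong [_] (trans (cong (_∸ pile a (suc r′)) ar′≡1+ar)
                                      (m+n∸n≡m 1 (pile a (suc r′)))))
      }

-- Termination of the path construction

Σ< : ℕ → (ℕ → ℕ) → ℕ
Σ< zero    f = 0
Σ< (suc n) f = f n + Σ< n f

Σ<-mono : ∀ n {f g} → (∀ i → f i ≤ g i) → Σ< n f ≤ Σ< n g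
Σ<-mono zero    le = z≤n
Σ<-mono (suc n) le = +-mono-≤ (le n) (Σ<-mono n le)

Σ<-strict : ∀ {n f g k} → (∀ i → f i ≤ g i) → f k < g k → k < n → Σ< n f < Σ< n g
Σ<-strict {suc n} {k = k} le lt k<1+n with m≤n⇒m<n∨m≡n (s≤s⁻¹ k<1+n)
... | inj₁ k<n  = +-mono-≤-< (le n) (Σ<-strict le lt k<n)
... | inj₂ refl = +-mono-<-≤ lt (Σ<-mono n le)

-- Cutting the sum at the length of `b` loses nothing: beyond it `tail b` is 0, and so is the
-- truncated difference.
gapSum : Config → Config → ℕ
gapSum a b = Σ< (length (piles b)) (λ n → tail b n ∸ tail a n)

gapSum-decreases : ∀ {a a′ b} → a ⟶ a′ → a′ ≽ b → gapSum a′ b < gapSum a b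
gapSum-decreases {a} {a′} {b} s a′≽b
  with i , j , i<j , sh ← ⟶⇒shifts s
  with n , an<a′n ← shifts-strict {a = a} {a′} i<j sh =
  Σ<-strict {k = n} (λ k → ∸-monoʳ-≤ (tail b k) (shifts-≽ {a = a} {a′} i<j sh k))
            (∸-monoʳ-< an<a′n (a′≽b n))
            (≰⇒> λ len≤n → contradiction
              (subst (tail a n <_) (tail-beyond b len≤n) (<-≤-trans an<a′n (a′≽b n))) λ ())

-- As long as some pile of `a` is lower than that of `b`, take a step that stays above `b`; `gapSum`
-- strictly decreases and bounds the number of steps.
≽⇒⟶* : ∀ {a b} → a ≽ b → a ⟶* b
≽⇒⟶* {a} {b} = go (suc (gapSum a b)) ≤-refl
  where
  go : ∀ k {a} → gapSum a b < k → a ≽ b → a ⟶* b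
  go (suc k) {a} (s≤s gap≤k) a≽b with anyUpTo? (λ n → pile a n <? pile b n) (length (piles b))
  ... | yes (t , _ , at<bt) with a′ , s , a′≽b ← stepTowards {a} {b} a≽b at<bt =
    s ◅ go k (<-≤-trans (gapSum-decreases {b = b} s a′≽b) gap≤k) a′≽b
  -- No pile of `a` is lower than that of `b`, so the tail sums of `b` are at most those of `a`, and
  -- with `a ≽ b` the two coincide.
  ... | no none = subst (a ⟶*_) (≽-antisym {a} {b} a≽b (tail-mono b a b≤a)) ε
    where
    b≤a : ∀ n → pile b n ≤ pile a n
    b≤a n with n <? length (piles b)
    ... | yes n<len = ≮⇒≥ (λ lt → none (n , n<len , lt))
    ... | no n≮len  = subst (_≤ pile a n) (sym (at-beyond (piles b) (≮⇒≥ n≮len))) z≤n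

-- Meets

maxTail : Config → Config → ℕ → ℕ
maxTail a b n = tail a n ⊔ tail b n

maxTail-beyond : ∀ a b {n} → length (piles a) ⊔ length (piles b) ≤ n → maxTail a b n ≡ 0
maxTail-beyond a b N≤n = cong₂ _⊔_
  (tail-beyond a (m⊔n≤o⇒m≤o _ (length (piles b)) N≤n))
  (tail-beyond b (m⊔n≤o⇒n≤o (length (piles a)) _ N≤n))

-- A pointwise maximum of convex sequences is convex: at n + 1 use the sequence
-- attaining the maximum there.
dominating-antitone : ∀ a (M : ℕ → ℕ) → (∀ n → tail a n ≤ M n) →
                      ∀ n → M (suc n) ≡ tail a (suc n) →
                      M (suc n) ∸ M (suc (suc n)) ≤ M n ∸ M (suc n)
dominating-antitone a M a≤M n eq rewrite eq = begin
  tail a (suc n) ∸ M (suc (suc n))       ≤⟨ ∸-monoʳ-≤ (tail a (suc n)) (a≤M (suc (suc n))) ⟩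
  tail a (suc n) ∸ tail a (suc (suc n))  ≡⟨ sym (pile-tail a (suc n)) ⟩
  pile a (suc n)                         ≤⟨ pile-antitone a n ⟩
  pile a n                               ≡⟨ pile-tail a n ⟩
  tail a n ∸ tail a (suc n)              ≤⟨ ∸-monoˡ-≤ (tail a (suc n)) (a≤M n) ⟩
  M n ∸ tail a (suc n)                   ∎
  where open ≤-Reasoning

-- Piles are recovered from the desired tail sums as differences, which telescope back to `maxTail`
-- because it is antitone.
meetWithTail : ∀ a b → ∃ λ c → ∀ n → tail c n ≡ maxTail a b n
meetWithTail a b = c , descending _ (N ⊔ length (piles c))
  (λ n le → trans (tail-beyond c (m⊔n≤o⇒n≤o N _ le))
                  (sym (maxTail-beyond a b (m⊔n≤o⇒m≤o N _ le))))
  (λ n ih → begin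
    tail c n                          ≡⟨ tail-suc c n ⟩
    pile c n + tail c (suc n)         ≡⟨ cong₂ _+_ (eq n) ih ⟩
    M n ∸ M (suc n) + M (suc n)       ≡⟨ m∸n+n≡m (⊔-mono-≤ (tail-antitone a n) (tail-antitone b n)) ⟩
    M n                               ∎)
  where
  open ≡-Reasoning
  N = length (piles a) ⊔ length (piles b)
  M = maxTail a b
  anti : Antitone (λ n → M n ∸ M (suc n))
  anti n with ≤-total (tail a (suc n)) (tail b (suc n))
  ... | inj₁ a≤b = dominating-antitone b M (λ n → m≤n⊔m _ _) n (m≤n⇒m⊔n≡n a≤b)
  ... | inj₂ b≤a = dominating-antitone a M (λ n → m≤m⊔n _ _) n (m≥n⇒m⊔n≡m b≤a)
  built = fromFunction N (λ n → M n ∸ M (suc n)) anti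
            (trans (cong (_∸ M (suc N)) (maxTail-beyond a b {N} ≤-refl)) (0∸n≡0 (M (suc N))))
  c = proj₁ built
  eq = proj₂ built

meet : Config → Config → Config
meet a b = proj₁ (meetWithTail a b)

tail-meet : ∀ a b n → tail (meet a b) n ≡ maxTail a b n
tail-meet a b = proj₂ (meetWithTail a b)

meet-≽ˡ : ∀ a b → a ≽ meet a b
meet-≽ˡ a b n = ≤-trans (m≤m⊔n _ _) (≤-reflexive (sym (tail-meet a b n)))

meet-≽ʳ : ∀ a b → b ≽ meet a b
meet-≽ʳ a b n = ≤-trans (m≤n⊔m _ _) (≤-reflexive (sym (tail-meet a b n)))

meet-greatest : ∀ a b {c} → a ≽ c → b ≽ c → meet a b ≽ c
meet-greatest a b a≽c b≽c n = ≤-trans (≤-reflexive (tail-meet a b n)) (⊔-lub (a≽c n) (b≽c n))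

-- Joins, as meets of the finitely many upper bounds

⋀ : List Config → Config
⋀ = foldr meet ⟨∞⟩

⋀-≽ : ∀ {c cs} → c ∈ cs → c ≽ ⋀ cs
⋀-≽ {cs = c ∷ cs} (here refl) n = meet-≽ˡ c (⋀ cs) n
⋀-≽ {cs = c ∷ cs} (there c∈)  n = ≤-trans (⋀-≽ c∈ n) (meet-≽ʳ c (⋀ cs) n)

⋀-greatest : ∀ {cs b} → All (_≽ b) cs → ⋀ cs ≽ b
⋀-greatest {b = b} []         = ⟨∞⟩-≽ b
⋀-greatest {c ∷ cs} {b} (p ∷ ps) = meet-greatest c (⋀ cs) {b} p (⋀-greatest {b = b} ps)

-- A finite superset of the positive lists with sum at most the bound. The bound drops by 1 per
-- entry because each entry is positive, and `upTo (2 + k)` holds the values up to `suc k`.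
boundedLists : ℕ → List (List ℕ)
boundedLists zero    = [] ∷ []
boundedLists (suc k) = [] ∷ cartesianProductWith _∷_ (upTo (2 + k)) (boundedLists k)

∈-boundedLists : ∀ k {xs} → All (0 <_) xs → sum xs ≤ k → xs ∈ boundedLists k
∈-boundedLists zero    []             _ = here refl
∈-boundedLists (suc k) []             _ = here refl
∈-boundedLists zero    (0<x ∷ _) x+xs≤0 = contradiction (m+n≤o⇒m≤o _ x+xs≤0) (<⇒≱ 0<x)
∈-boundedLists (suc k) {suc x ∷ xs} (_ ∷ ps) (s≤s x+xs≤k) = there
  (∈-cartesianProductWith⁺ _∷_ (∈-upTo⁺ (s≤s (s≤s (m+n≤o⇒m≤o x x+xs≤k))))
    (∈-boundedLists k ps (m+n≤o⇒n≤o x x+xs≤k)))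

-- Lists that are not configurations are sent to the top element, which is
-- harmless in a meet.
toConfig : List ℕ → Config
toConfig xs with linked? _≥?_ xs | all? (0 <?_) xs
... | yes l | yes p = config xs l p
... | _     | _     = ⟨∞⟩

toConfig-piles : ∀ a → toConfig (piles a) ≡ a
toConfig-piles a with linked? _≥?_ (piles a) | all? (0 <?_) (piles a)
... | yes l | yes p = piles-injective refl
... | no ¬l | _     = contradiction (nonIncreasing a) ¬l
... | yes _ | no ¬p = contradiction (positive a) ¬p

_≽?_ : ∀ a b → Dec (a ≽ b)
a ≽? b = map′ extend (λ a≽b {n} _ → a≽b n)
              (allUpTo? (λ n → tail a n ≤? tail b n) (length (piles a)))
  where
  extend : (∀ {n} → n < length (piles a) → tail a n ≤ tail b n) → a ≽ b
  extend le n with n <? length (piles a)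
  ... | yes n<len = le n<len
  ... | no n≮len  = subst (_≤ tail b n) (sym (tail-beyond a (≮⇒≥ n≮len))) z≤n

upperBound? : ∀ a b c → Dec (c ≽ a × c ≽ b)
upperBound? a b c = (c ≽? a) ×-dec (c ≽? b)

-- An upper bound of `a` has at most `tail a 0` grains in its finite columns, so every candidate
-- occurs in the enumeration.
upperBounds : Config → Config → List Config
upperBounds a b = filter (upperBound? a b) (map toConfig (boundedLists (tail a 0)))

∈-upperBounds : ∀ {a b c} → c ≽ a → c ≽ b → c ∈ upperBounds a b
∈-upperBounds {a} {b} {c} c≽a c≽b = ∈-filter⁺ (upperBound? a b)
  (subst (_∈ map toConfig (boundedLists (tail a 0))) (toConfig-piles c)
    (∈-map⁺ toConfig (∈-boundedLists (tail a 0) (positive c) (c≽a 0))))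
  (c≽a , c≽b)

join : Config → Config → Config
join a b = ⋀ (upperBounds a b)

allUpperBounds : ∀ a b → All (λ c → c ≽ a × c ≽ b) (upperBounds a b)
allUpperBounds a b = all-filter (upperBound? a b) (map toConfig (boundedLists (tail a 0)))

join-≽ˡ : ∀ a b → join a b ≽ a
join-≽ˡ a b = ⋀-greatest {b = a} (All.map proj₁ (allUpperBounds a b))

join-≽ʳ : ∀ a b → join a b ≽ b
join-≽ʳ a b = ⋀-greatest {b = b} (All.map proj₂ (allUpperBounds a b))

join-least : ∀ a b {c} → c ≽ a → c ≽ b → c ≽ join a b
join-least a b {c} c≽a c≽b = ⋀-≽ (∈-upperBounds {a} {b} {c} c≽a c≽b)

-- The lattice of reachable configurations

reachable : Config → L[∞]
reachable a = a , ≽⇒⟶* (⟨∞⟩-≽ a)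

theorem2 : ∃₂ λ (_∨_ _∧_ : Op₂ L[∞]) →
    IsLattice _≈ᴸ_ _≤ᴸ_ _∨_ _∧_ ×
    (∀ (a b : L[∞]) → let c = a ∧ b in
    (∀ (i : ℕ) → i < width a ⊔ width b →
    + column c i ≡ + (tailSum a i ⊔ tailSum b i) - + tailSum c (suc i)) ×
    (∀ (i : ℕ) → width a ⊔ width b ≤ i → column c i ≡ 0))
theorem2 = _∨_ , _∧_ , isLattice , λ a b → (λ i _ → columns a b i) , outside a b
  where
  _∨_ _∧_ : Op₂ L[∞]
  (a , _) ∨ (b , _) = reachable (join a b)
  (a , _) ∧ (b , _) = reachable (meet a b)

  isLattice : IsLattice _≈ᴸ_ _≤ᴸ_ _∨_ _∧_
  isLattice = record
    { isPartialOrder = record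
      { isPreorder = record
        { isEquivalence = On.isEquivalence proj₁ isEquivalence
        ; reflexive     = λ { refl → ε }
        -- The order reverses the direction of paths, so the second path is traversed first.
        ; trans         = λ b≤a c≤b → c≤b ◅◅ b≤a
        }
      ; antisym = λ {(a , _)} {(b , _)} b⟶*a a⟶*b →
          ≽-antisym {a} {b} (⟶*⇒≽ a⟶*b) (⟶*⇒≽ b⟶*a)
      }
    ; supremum = λ { (a , _) (b , _) →
        ≽⇒⟶* (join-≽ˡ a b) , ≽⇒⟶* (join-≽ʳ a b) ,
        λ { (c , _) a≤c b≤c →
          ≽⇒⟶* (join-least a b {c} (⟶*⇒≽ a≤c) (⟶*⇒≽ b≤c)) } }
    ; infimum = λ { (a , _) (b , _) →
        ≽⇒⟶* (meet-≽ˡ a b) , ≽⇒⟶* (meet-≽ʳ a b) ,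
        λ { (c , _) c≤a c≤b →
          ≽⇒⟶* (meet-greatest a b {c} (⟶*⇒≽ c≤a) (⟶*⇒≽ c≤b)) } }
    }

  columns : ∀ a b i → + column (a ∧ b) i ≡
            + (tailSum a i ⊔ tailSum b i) - + tailSum (a ∧ b) (suc i)
  columns (a , _) (b , _) i = begin
    + pile c i                            ≡⟨ cong +_ (pile-tail c i) ⟩
    -- Tail sums are antitone, so truncated subtraction agrees with integer subtraction.
    + (tail c i ∸ tail c (suc i))         ≡⟨ sym (ℤ.⊖-≥ (tail-antitone c i)) ⟩
    tail c i ⊖ tail c (suc i)             ≡⟨ sym (ℤ.m-n≡m⊖n (tail c i) (tail c (suc i))) ⟩
    + tail c i - + tail c (suc i)         ≡⟨ cong (λ x → + x - + tail c (suc i)) (tail-meet a b i) ⟩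
    + maxTail a b i - + tail c (suc i)    ∎
    where
    open ≡-Reasoning
    c = meet a b

  outside : ∀ a b i → width a ⊔ width b ≤ i → column (a ∧ b) i ≡ 0
  outside (a , _) (b , _) i N≤i = begin
    pile c i                     ≡⟨ pile-tail c i ⟩
    tail c i ∸ tail c (suc i)
      ≡⟨ cong (_∸ tail c (suc i)) (trans (tail-meet a b i) (maxTail-beyond a b N≤i)) ⟩
    0 ∸ tail c (suc i)           ≡⟨ 0∸n≡0 (tail c (suc i)) ⟩
    0                            ∎
    where
    open ≡-Reasoning
    c = meet a b
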